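{- Let $X=\{a,b\}$, let $u=u_1\dots u_d$ be a nonempty finite non-periodic word over $X$ and $W=u^\infty$. Let $v_0,v_1,\dots,v_n$ be all forks of $W$, ordered so that $z_0\le z_1\le\dots\le z_n$ where $z_i=z(v_i)$, with $v_0=W$ and $v_n=\Lambda$. For every exceptional index $i$, let $j(i)$ denote the index with $v_{j(i)}=\Psi(v_i)$. Then for each exceptional index $i$ there exists an index $k(i)$ with $i<k(i)<j(i)$ such that $z_{j(i)}\le z_{j(i)-1}+z_{i-1}$ and $z_{k(i)}\le z_{k(i)-1}+z_{i-2}$. Moreover, $j(i)\ne j(i')$ for distinct exceptional indices $i\ne i'$; no $k(i)$ equals any $j(i')$ ($i,i'$ exceptional); and all indices $j(i)$ and $k(i)$ are regular.
   Context: A nonempty finite word is periodic if it equals $v^m$ for some word $v$ and $m\ge2$. $W=u^\infty$ is the two-sided infinite word with period $u$; $\Lambda$ is the empty word. $v\preceq w$ means $v$ is a subword of $w$ (for finite $v$ and $w=W$: $v$ occurs in $W$); $\prec$ means proper subword. A fork is a finite word $v$ such that $va,vb,av,bv$ are all subwords of $W$; by convention $W$ itself is also a fork. Significance: for a finite word $v$ of length $t$, $z(v)=|\{1\le i\le d: u_i\dots u_{i+t-1}=v\}|$, where indices are taken cyclically ($u_{i+d}=u_i$); $z(W)=1$. An index $i\ge2$ (and the fork $v_i$) is exceptional if $z_i>z_{i-1}+z_{i-2}$; otherwise (and always for $i=0,1$) it is regular. For an exceptional fork $v_i$, $\Psi(v_i)$ is the longest proper prefix of $v_{i-1}$ that is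 a fork. -}

module Defs where

open import Data.Nat using (ℕ; zero; suc; _+_; _*_; _∸_; _≤_; _<_)
open import Data.List using (List; []; _∷_; _++_; length; take; drop; concat; replicate; filter; upTo; [_])
open import Data.List.Properties using (≡-dec)
open import Data.Product using (Σ; ∃; _×_; _,_)
open import Data.Unit using (⊤)
open import Data.Empty using (⊥)
open import Relation.Nullary using (¬_; Dec; yes; no)
open import Relation.Binary.PropositionalEquality using (_≡_; _≢_; refl)
open import Relation.Binary.Definitions using (DecidableEquality)

data Letter : Set where
  a b : Letter

_≟L_ : DecidableEquality Letter
a ≟L a = yes refl
a ≟L b = no λ ()
b ≟L a = no λ ()
b ≟L b = yes refl

Word : Set
Word = List Letter

_≟W_ : DecidableEquality Word
_≟W_ = ≡-dec _≟L_

pow : Word → ℕ → Word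
pow v m = concat (replicate m v)

Periodic : Word → Set
Periodic w = ∃ λ v → ∃ λ m → 2 ≤ m × w ≡ pow v m

-- The length-t factor of the two-sided infinite word W = u^∞ starting at
-- (cyclic, 0-based) position i, i.e. u_i … u_{i+t-1} with indices mod d.
-- For i < d = length u (u nonempty), u^(t+1) is long enough.
factor : Word → ℕ → ℕ → Word
factor u i t = take t (drop i (pow u (suc t)))

OccursAt : Word → ℕ → Word → Set
OccursAt u i v = factor u i (length v) ≡ v

Sub : Word → Word → Set
Sub u v = ∃ λ i → i < length u × OccursAt u i v

z : Word → Word → ℕ
z u v = length (filter (λ i → factor u i (length v) ≟W v) (upTo (length u)))

data Fork : Set where
  W   : Fork
  fin : Word → Fork

-- fork of W = u^∞ (W itself is a fork by convention)
IsFork : Word → Fork → Set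
IsFork u W       = ⊤
IsFork u (fin v) = Sub u (v ++ [ a ]) × Sub u (v ++ [ b ]) × Sub u (a ∷ v) × Sub u (b ∷ v)

zF : Word → Fork → ℕ
zF u W       = 1
zF u (fin v) = z u v

ProperPrefix : Word → Word → Set
ProperPrefix w x = ∃ λ s → s ≢ [] × w ++ s ≡ x

PsiOf : Word → Fork → Fork → Set
PsiOf u W       _       = ⊥
PsiOf u (fin x) W       = ⊥
PsiOf u (fin x) (fin w) =
  ProperPrefix w x × IsFork u (fin w) ×
  (∀ w' → ProperPrefix w' x → IsFork u (fin w') → length w' ≤ length w)

record ForkEnumeration (u : Word) (n : ℕ) : Set where
  field
    v      : ℕ → Fork
    fork   : ∀ i → i ≤ n → IsFork u (v i)
    inj    : ∀ i j → i ≤ n → j ≤ n → v i ≡ v j → i ≡ j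
    surj   : ∀ f → IsFork u f → ∃ λ i → i ≤ n × v i ≡ f
    mono   : ∀ i j → i ≤ j → j ≤ n → zF u (v i) ≤ zF u (v j)
    first  : v 0 ≡ W
    last   : v n ≡ fin []

  zs : ℕ → ℕ
  zs i = zF u (v i)

  Exceptional : ℕ → Set
  Exceptional i = 2 ≤ i × i ≤ n × zs (i ∸ 1) + zs (i ∸ 2) < zs i

  Regular : ℕ → Set
  Regular i = ¬ Exceptional i

{-# OPTIONS --safe #-}

-- Write z for the significance. It is additive, z w = z (w a) + z (w b) = z (a w) + z (b w), and since u is
-- primitive every word w with z w > 1 extends to a fork of the same significance. So every value of z occurs among
-- the z_i, and for an exceptional i this forces z_{i-2} < z_{i-1}, z_i = 2 z_{i-1} and z (v_i y) = z_{i-1} for both y.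
--
-- Let F = v_{i-1} and G = v_{j(i)}, with G x a prefix of F. No prefix between G and F is a fork, so z (G x) = z F;
-- this gives z_{j(i)} ≤ z_{j(i)-1} + z_{i-1}. Since z G ≥ 2 z F, some letter c has z (c G) ≥ z F; let K be the fork
-- obtained by extending c G to the left. As z (K x) = z (c G x) = z (c F) < z F we get z (K x) ≤ z_{i-2}, and so
-- K = v_k satisfies the second inequality, with k < j(i). It also shows K ≠ v_i. If z (c G) = z F for both letters,
-- then c can be chosen with K ≠ F, hence k > i.
--
-- This K may happen to be v_{j(e)} for another exceptional e, but then e < i, and the same construction applied to
-- e instead of i still yields an index greater than i, because z_{j(e)} = z_k ≥ z_i.

module Submission where

open import Defs
open import Data.Nat using (ℕ; zero; suc; _+_; _*_; _∸_; _≤_; _<_; _≤?_; _<?_; z≤n; s≤s; z<s; s≤s⁻¹; NonZero; ≢-nonZero)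
open import Data.Nat.Properties
open import Data.Nat.DivMod using (_/_; _%_; m≡m%n+[m/n]*n; m%n<n; m<n⇒m%n≡m; [m+n]%n≡m%n)
open import Data.Nat.Divisibility using (divides; ∣⇒≤)
open import Data.Nat.GCD using (gcd; gcd[m,n]∣m; gcd[m,n]∣n; gcd-GCD; module Bézout)
open import Data.Nat.Induction using (<-wellFounded)
open import Induction.WellFounded using (Acc; acc)
open import Data.Nat.ListAction using (sum)
open import Data.Nat.ListAction.Properties using (sum-++)
open import Data.List using ([]; _∷_; _++_; _∷ʳ_; [_]; length; take; drop; filter; map; applyUpTo; upTo)
open import Data.List.Properties hiding (sum-++)
open import Data.List.Membership.Propositional using (_∈_; lose)
open import Data.List.Membership.Propositional.Properties using (∈-filter⁻; ∈-upTo⁺; ∈-upTo⁻)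
open import Data.List.Relation.Unary.Any using (here; there)
open import Data.List.Relation.Unary.All using ([]; _∷_)
open import Data.List.Relation.Unary.AllPairs using ([]; _∷_)
open import Data.List.Relation.Unary.Unique.Propositional using (Unique)
import Data.List.Relation.Unary.Unique.Propositional.Properties as Unique
open import Data.Product using (Σ; ∃; _×_; _,_; proj₁; proj₂)
open import Data.Sum as Sum using (_⊎_; inj₁; inj₂; [_,_]′)
open import Algebra.Properties.CommutativeSemigroup +-commutativeSemigroup using (interchange; x∙yz≈y∙xz; x∙yz≈yx∙z)
open import Function using (_∘_; id)
open import Relation.Nullary.Decidable using (_×-dec_)
open import Relation.Nullary using (¬_; Dec; yes; no; contradiction)
open import Relation.Unary using (Pred; Decidable)
open import Relation.Binary.Definitions using (tri<; tri≈; tri>)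
open import Relation.Binary.PropositionalEquality using (_≡_; _≢_; refl; sym; trans; cong; cong₂; subst; subst₂; module ≡-Reasoning)

+-squeeze : ∀ {m m′ n n′} → m ≤ m′ → n ≤ n′ → m + n ≡ m′ + n′ → m ≡ m′
+-squeeze m≤m′ n≤n′ eq with m≤n⇒m<n∨m≡n m≤m′
... | inj₂ m≡m′ = m≡m′
... | inj₁ m<m′ = contradiction eq (<⇒≢ (+-mono-<-≤ m<m′ n≤n′))

n≡0⊎n>0 : ∀ n → n ≡ 0 ⊎ 0 < n
n≡0⊎n>0 zero    = inj₁ refl
n≡0⊎n>0 (suc n) = inj₂ z<s

-- Counting

Σ< : ℕ → (ℕ → ℕ) → ℕ
Σ< n f = sum (applyUpTo f n)

Σ<-cong : ∀ n {f g} → (∀ i → i < n → f i ≡ g i) → Σ< n f ≡ Σ< n g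
Σ<-cong zero    f≗g = refl
Σ<-cong (suc n) f≗g = cong₂ _+_ (f≗g 0 z<s) (Σ<-cong n λ i i<n → f≗g (suc i) (s≤s i<n))

Σ<-+ : ∀ n f g → Σ< n (λ i → f i + g i) ≡ Σ< n f + Σ< n g
Σ<-+ zero    f g = refl
Σ<-+ (suc n) f g = begin
  f 0 + g 0 + Σ< n (λ i → f (suc i) + g (suc i))            ≡⟨ cong (f 0 + g 0 +_) (Σ<-+ n (f ∘ suc) (g ∘ suc)) ⟩
  f 0 + g 0 + (Σ< n (f ∘ suc) + Σ< n (g ∘ suc))             ≡⟨ interchange (f 0) (g 0) _ _ ⟩
  f 0 + Σ< n (f ∘ suc) + (g 0 + Σ< n (g ∘ suc))             ∎
  where open ≡-Reasoning

-- Both sides, once `f 0` is added, equal the sum over `suc n` terms. This is the rotation of a sum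
-- over cyclic positions.
Σ<-shift : ∀ n f → f n ≡ f 0 → Σ< n (f ∘ suc) ≡ Σ< n f
Σ<-shift n f fn≡f0 = +-cancelˡ-≡ (f 0) _ _ (begin
  Σ< (suc n) f                      ≡⟨ cong sum (applyUpTo-∷ʳ f n) ⟨
  sum (applyUpTo f n ∷ʳ f n)        ≡⟨ sum-++ (applyUpTo f n) [ f n ] ⟩
  Σ< n f + (f n + 0)                ≡⟨ cong (Σ< n f +_) (trans (+-identityʳ (f n)) fn≡f0) ⟩
  Σ< n f + f 0                      ≡⟨ +-comm (Σ< n f) (f 0) ⟩
  f 0 + Σ< n f                      ∎)
  where open ≡-Reasoning

⟦_⟧ : ∀ {p} {P : Set p} → Dec P → ℕ
⟦ yes _ ⟧ = 1
⟦ no  _ ⟧ = 0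

length-filter-⟦⟧ : ∀ {a p} {A : Set a} {P : Pred A p} (P? : Decidable P) xs →
                   length (filter P? xs) ≡ sum (map (⟦_⟧ ∘ P?) xs)
length-filter-⟦⟧ P? []       = refl
length-filter-⟦⟧ P? (x ∷ xs) with P? x
... | yes _ = cong suc (length-filter-⟦⟧ P? xs)
... | no  _ = length-filter-⟦⟧ P? xs

⟦⟧-⇔ : ∀ {p q} {P : Set p} {Q : Set q} (P? : Dec P) (Q? : Dec Q) →
       (P → Q) → (Q → P) → ⟦ P? ⟧ ≡ ⟦ Q? ⟧
⟦⟧-⇔ (yes _) (yes _)  f g = refl
⟦⟧-⇔ (yes p) (no ¬q)  f g = contradiction (f p) ¬q
⟦⟧-⇔ (no ¬p) (yes q)  f g = contradiction (g q) ¬p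
⟦⟧-⇔ (no _)  (no _)   f g = refl

⟦⟧-⊎ : ∀ {p q r} {P : Set p} {Q : Set q} {R : Set r} (P? : Dec P) (Q? : Dec Q) (R? : Dec R) →
       (P → Q ⊎ R) → (Q → P) → (R → P) → (Q → ¬ R) → ⟦ P? ⟧ ≡ ⟦ Q? ⟧ + ⟦ R? ⟧
⟦⟧-⊎ _       (yes q) (yes r) f g h x = contradiction r (x q)
⟦⟧-⊎ P?      (yes q) (no _)  f g h x = ⟦⟧-⇔ P? (yes q) (λ _ → q) g
⟦⟧-⊎ P?      (no _)  (yes r) f g h x = ⟦⟧-⇔ P? (yes r) (λ _ → r) h
⟦⟧-⊎ (yes p) (no ¬q) (no ¬r) f g h x with f p
... | inj₁ q = contradiction q ¬q
... | inj₂ r = contradiction r ¬r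
⟦⟧-⊎ (no _)  (no _)  (no _)  f g h x = refl

length-filter≤1 : ∀ {a p} {A : Set a} {P : Pred A p} (P? : Decidable P) {xs} → Unique xs →
                  (∀ {x y} → x ∈ xs → P x → y ∈ xs → P y → x ≡ y) → length (filter P? xs) ≤ 1
length-filter≤1 P? {xs} xs! P≡ with filter P? xs | Unique.filter⁺ P? xs! | (λ {x} → ∈-filter⁻ P? {x} {xs})
... | []         | _                 | _   = z≤n
... | _ ∷ []     | _                 | _   = s≤s z≤n
... | x ∷ y ∷ _  | (x≢y ∷ _) ∷ _     | ∈⁻  =
  contradiction (P≡ (proj₁ x∈) (proj₂ x∈) (proj₁ y∈) (proj₂ y∈)) x≢y
  where
  x∈ = ∈⁻ (here refl)
  y∈ = ∈⁻ (there (here refl))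

-- Factors of a sequence of letters

segment : (ℕ → Letter) → ℕ → ℕ → Word
segment s i zero    = []
segment s i (suc t) = s i ∷ segment s (suc i) t

segment-∘suc : ∀ s i t → segment (s ∘ suc) i t ≡ segment s (suc i) t
segment-∘suc s i zero    = refl
segment-∘suc s i (suc t) = cong (s (suc i) ∷_) (segment-∘suc s (suc i) t)

module _ (s : ℕ → Letter) where

  open ≡-Reasoning

  segment-∷ʳ : ∀ i t → segment s i (suc t) ≡ segment s i t ∷ʳ s (i + t)
  segment-∷ʳ i zero    = cong (λ k → [ s k ]) (sym (+-identityʳ i))
  segment-∷ʳ i (suc t) = cong (s i ∷_) (begin
    segment s (suc i) (suc t)                 ≡⟨ segment-∷ʳ (suc i) t ⟩
    segment s (suc i) t ∷ʳ s (suc i + t)      ≡⟨ cong (λ k → segment s (suc i) t ∷ʳ s k) (+-suc i t) ⟨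
    segment s (suc i) t ∷ʳ s (i + suc t)      ∎)

  segment-++ : ∀ i t t′ → segment s i (t + t′) ≡ segment s i t ++ segment s (i + t) t′
  segment-++ i zero    t′ = cong (λ k → segment s k t′) (sym (+-identityʳ i))
  segment-++ i (suc t) t′ = cong (s i ∷_) (trans (segment-++ (suc i) t t′)
    (cong (λ k → segment s (suc i) t ++ segment s k t′) (sym (+-suc i t))))

  segment-≗ : ∀ i i′ t → (∀ k → k < t → s (i + k) ≡ s (i′ + k)) → segment s i t ≡ segment s i′ t
  segment-≗ i i′ zero    eq = refl
  segment-≗ i i′ (suc t) eq = cong₂ _∷_
    (subst₂ (λ m n → s m ≡ s n) (+-identityʳ i) (+-identityʳ i′) (eq 0 z<s))
    (segment-≗ (suc i) (suc i′) t λ k k<t →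
      subst₂ (λ m n → s m ≡ s n) (+-suc i k) (+-suc i′ k) (eq (suc k) (s≤s k<t)))

  segment-injective : ∀ i i′ t → segment s i t ≡ segment s i′ t → ∀ k → k < t → s (i + k) ≡ s (i′ + k)
  segment-injective i i′ (suc t) eq zero    _         =
    subst₂ (λ m n → s m ≡ s n) (sym (+-identityʳ i)) (sym (+-identityʳ i′)) (∷-injectiveˡ eq)
  segment-injective i i′ (suc t) eq (suc k) (s≤s k<t) =
    subst₂ (λ m n → s m ≡ s n) (sym (+-suc i k)) (sym (+-suc i′ k))
      (segment-injective (suc i) (suc i′) t (∷-injectiveʳ eq) k k<t)

  segment-pow : ∀ g → (∀ i → s (i + g) ≡ s i) → ∀ m → segment s 0 (m * g) ≡ pow (segment s 0 g) m
  segment-pow g per zero    = refl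
  segment-pow g per (suc m) = begin
    segment s 0 (g + m * g)                    ≡⟨ segment-++ 0 g (m * g) ⟩
    segment s 0 g ++ segment s g (m * g)       ≡⟨ cong (segment s 0 g ++_) (segment-≗ g 0 (m * g) λ k _ → trans (cong s (+-comm g k)) (per k)) ⟩
    segment s 0 g ++ segment s 0 (m * g)       ≡⟨ cong (segment s 0 g ++_) (segment-pow g per m) ⟩
    segment s 0 g ++ pow (segment s 0 g) m     ∎

-- Periods of a sequence

period-* : ∀ {ℓ} {A : Set ℓ} (s : ℕ → A) {p} → (∀ i → s (i + p) ≡ s i) → ∀ m i → s (i + m * p) ≡ s i
period-* s         per zero    i = cong s (+-identityʳ i)
period-* s {p = p} per (suc m) i = begin
  s (i + (p + m * p))   ≡⟨ cong s (+-assoc i p (m * p)) ⟨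
  s (i + p + m * p)     ≡⟨ period-* s per m (i + p) ⟩
  s (i + p)             ≡⟨ per i ⟩
  s i                   ∎
  where open ≡-Reasoning

-- By Bézout the gcd is a difference of multiples of the two periods. Since `s` is indexed by
-- naturals, the two signs of the identity are separate cases, both covered by `combine`.
period-gcd : ∀ {ℓ} {A : Set ℓ} (s : ℕ → A) p q → (∀ i → s (i + p) ≡ s i) → (∀ i → s (i + q) ≡ s i) →
             ∀ i → s (i + gcd p q) ≡ s i
period-gcd s p q per-p per-q i = bézout (Bézout.identity (gcd-GCD p q))
  where
  open ≡-Reasoning
  g = gcd p q

  combine : ∀ {p q} → (∀ i → s (i + p) ≡ s i) → (∀ i → s (i + q) ≡ s i) →
            ∀ x y → g + y * q ≡ x * p → s (i + g) ≡ s i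
  combine {p} {q} per-p per-q x y eq = begin
    s (i + g)            ≡⟨ period-* s per-q y (i + g) ⟨
    s (i + g + y * q)    ≡⟨ cong s (trans (+-assoc i g (y * q)) (cong (i +_) eq)) ⟩
    s (i + x * p)        ≡⟨ period-* s per-p x i ⟩
    s i                  ∎

  bézout : Bézout.Identity g p q → s (i + g) ≡ s i
  bézout (Bézout.+- x y eq) = combine per-p per-q x y eq
  bézout (Bézout.-+ x y eq) = combine per-q per-p y x eq

-- Off the end of the word the value is junk.
letter : Word → ℕ → Letter
letter []      _       = a
letter (x ∷ w) zero    = x
letter (x ∷ w) (suc k) = letter w k

letter-++ˡ : ∀ w w′ k → k < length w → letter (w ++ w′) k ≡ letter w k
letter-++ˡ (x ∷ w) w′ zero    _         = refl
letter-++ˡ (x ∷ w) w′ (suc k) (s≤s k<) = letter-++ˡ w w′ k k<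

letter-++ʳ : ∀ w w′ k → letter (w ++ w′) (length w + k) ≡ letter w′ k
letter-++ʳ []      w′ k = refl
letter-++ʳ (x ∷ w) w′ k = letter-++ʳ w w′ k

-- The sequence is universally quantified because the induction on the word replaces `s` by
-- `s ∘ suc`.
take-drop-segment : ∀ s w i t → i + t ≤ length w → (∀ k → k < length w → letter w k ≡ s k) →
            take t (drop i w) ≡ segment s i t
take-drop-segment s w       zero    zero    _         _  = refl
take-drop-segment s (x ∷ w) zero    (suc t) (s≤s t≤) eq = cong₂ _∷_ (eq 0 z<s)
  (trans (take-drop-segment (s ∘ suc) w 0 t t≤ λ k k< → eq (suc k) (s≤s k<)) (segment-∘suc s 0 t))
take-drop-segment s []      (suc i) zero    _         _  = refl
take-drop-segment s (x ∷ w) (suc i) t       (s≤s le) eq =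
  trans (take-drop-segment (s ∘ suc) w i t le λ k k< → eq (suc k) (s≤s k<)) (segment-∘suc s i t)

length-pow : ∀ u m → length (pow u m) ≡ m * length u
length-pow u zero    = refl
length-pow u (suc m) = trans (length-++ u) (cong (length u +_) (length-pow u m))

other : Letter → Letter
other a = b
other b = a

x≢other : ∀ x → x ≢ other x
x≢other a ()
x≢other b ()

x∨other : ∀ x y → y ≡ x ⊎ y ≡ other x
x∨other a a = inj₁ refl
x∨other a b = inj₂ refl
x∨other b a = inj₂ refl
x∨other b b = inj₁ refl

fin-injective : ∀ {w w′} → fin w ≡ fin w′ → w ≡ w′
fin-injective refl = refl

-- The letters just before the common suffix differ. This will separate left extensions of `a ∷ G`
-- from those of `b ∷ G`.
fin-++-≢ : ∀ {x y} w w′ z → x ≢ y → fin (w ++ x ∷ z) ≢ fin (w′ ++ y ∷ z)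
fin-++-≢ {x} {y} w w′ z x≢y eq = x≢y (∷ʳ-injectiveʳ w w′ (++-cancelʳ z _ _
  (trans (∷ʳ-++ w x z) (trans (fin-injective eq) (sym (∷ʳ-++ w′ y z))))))
-- Significance

module Significance (u : Word) (u≢[] : u ≢ []) where

  open ≡-Reasoning

  d : ℕ
  d = length u

  instance
    d-nonZero : NonZero d
    d-nonZero = ≢-nonZero (u≢[] ∘ length≡0 u)
      where
      length≡0 : ∀ (w : Word) → length w ≡ 0 → w ≡ []
      length≡0 [] _ = refl

  -- The right half of the two-sided word; by periodicity it contains all factors.
  s : ℕ → Letter
  s k = letter u (k % d)

  s-period : ∀ k → s (k + d) ≡ s k
  s-period k = cong (letter u) ([m+n]%n≡m%n k d)

  letter-pow : ∀ m k → k < m * d → letter (pow u m) k ≡ s k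
  letter-pow (suc m) k k< with k <? d
  ... | yes k<d = trans (letter-++ˡ u (pow u m) k k<d) (cong (letter u) (sym (m<n⇒m%n≡m k<d)))
  ... | no  k≮d = begin
    letter (u ++ pow u m) k         ≡⟨ cong (letter (u ++ pow u m)) d+k′≡k ⟨
    letter (u ++ pow u m) (d + k′)  ≡⟨ letter-++ʳ u (pow u m) k′ ⟩
    letter (pow u m) k′             ≡⟨ letter-pow m k′ (+-cancelˡ-< d _ _ (subst (_< d + m * d) (sym d+k′≡k) k<)) ⟩
    s k′                            ≡⟨ s-period k′ ⟨
    s (k′ + d)                      ≡⟨ cong s (trans (+-comm k′ d) d+k′≡k) ⟩
    s k                             ∎
    where
    k′ = k ∸ d
    d+k′≡k : d + k′ ≡ k
    d+k′≡k = m+[n∸m]≡n (≮⇒≥ k≮d)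

  factor≡segment : ∀ {i} t → i < d → factor u i t ≡ segment s i t
  factor≡segment {i} t i<d = take-drop-segment s (pow u (suc t)) i t
    -- The window ends at `i + t`, at most `d + t * d`, which is the length of the `suc t`-th power.
    (subst (i + t ≤_) (sym (length-pow u (suc t))) (+-mono-≤ (<⇒≤ i<d) (m≤m*n t d)))
    λ k k< → letter-pow (suc t) k (subst (k <_) (length-pow u (suc t)) k<)

  occurs? : ∀ v i → Dec (segment s i (length v) ≡ v)
  occurs? v i = segment s i (length v) ≟W v

  z≡Σ : ∀ v → z u v ≡ Σ< d λ i → ⟦ occurs? v i ⟧
  z≡Σ v = begin
    z u v                                ≡⟨ length-filter-⟦⟧ factor≟ (upTo d) ⟩
    sum (map (⟦_⟧ ∘ factor≟) (upTo d))   ≡⟨ cong sum (map-applyUpTo id (⟦_⟧ ∘ factor≟) d) ⟩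
    Σ< d (⟦_⟧ ∘ factor≟)                 ≡⟨ Σ<-cong d (λ i i<d → ⟦⟧-⇔ (factor≟ i) (occurs? v i)
                                              (trans (sym (factor≡segment (length v) i<d)))
                                              (trans (factor≡segment (length v) i<d))) ⟩
    (Σ< d λ i → ⟦ occurs? v i ⟧)         ∎
    where
    factor≟ : ∀ i → Dec (factor u i (length v) ≡ v)
    factor≟ i = factor u i (length v) ≟W v

  -- Each occurrence of `v` is followed by exactly one of the two letters.
  z-∷ʳ : ∀ v x → z u v ≡ z u (v ∷ʳ x) + z u (v ∷ʳ other x)
  z-∷ʳ v x = begin
    z u v
      ≡⟨ z≡Σ v ⟩
    (Σ< d λ i → ⟦ occurs? v i ⟧)
      ≡⟨ Σ<-cong d (λ i _ → split i) ⟩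
    (Σ< d λ i → ⟦ occurs? (v ∷ʳ x) i ⟧ + ⟦ occurs? (v ∷ʳ other x) i ⟧)
      ≡⟨ Σ<-+ d _ _ ⟩
    (Σ< d λ i → ⟦ occurs? (v ∷ʳ x) i ⟧) + (Σ< d λ i → ⟦ occurs? (v ∷ʳ other x) i ⟧)
      ≡⟨ cong₂ _+_ (z≡Σ (v ∷ʳ x)) (z≡Σ (v ∷ʳ other x)) ⟨
    z u (v ∷ʳ x) + z u (v ∷ʳ other x)
      ∎
    where
    t = length v

    snoc : ∀ i y → segment s i (length (v ∷ʳ y)) ≡ segment s i t ∷ʳ s (i + t)
    snoc i y = trans (cong (segment s i) (trans (length-++ v) (+-comm t 1))) (segment-∷ʳ s i t)

    ⇒ : ∀ i {y} → s (i + t) ≡ y → segment s i t ≡ v → segment s i (length (v ∷ʳ y)) ≡ v ∷ʳ y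
    ⇒ i {y} eq occ = trans (snoc i y) (cong₂ _∷ʳ_ occ eq)

    ⇐ : ∀ i {y} → segment s i (length (v ∷ʳ y)) ≡ v ∷ʳ y → segment s i t ≡ v × s (i + t) ≡ y
    ⇐ i {y} occ = ∷ʳ-injective _ _ (trans (sym (snoc i y)) occ)

    split : ∀ i → ⟦ occurs? v i ⟧ ≡ ⟦ occurs? (v ∷ʳ x) i ⟧ + ⟦ occurs? (v ∷ʳ other x) i ⟧
    split i = ⟦⟧-⊎ (occurs? v i) (occurs? (v ∷ʳ x) i) (occurs? (v ∷ʳ other x) i)
      (λ occ → Sum.map (λ eq → ⇒ i eq occ) (λ eq → ⇒ i eq occ) (x∨other x (s (i + t))))
      (λ occ → proj₁ (⇐ i occ))
      (λ occ → proj₁ (⇐ i occ))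
      (λ occ occ′ → x≢other x (trans (sym (proj₂ (⇐ i occ))) (proj₂ (⇐ i occ′))))

  -- Each occurrence of `v` is preceded by exactly one letter. Counting at the positions `suc i`
  -- instead of `i` makes the position of that letter a natural number; cyclicity leaves the count
  -- unchanged.
  z-∷ : ∀ v x → z u v ≡ z u (x ∷ v) + z u (other x ∷ v)
  z-∷ v x = begin
    z u v
      ≡⟨ z≡Σ v ⟩
    (Σ< d λ i → ⟦ occurs? v i ⟧)
      ≡⟨ Σ<-shift d _ wrap ⟨
    (Σ< d λ i → ⟦ occurs? v (suc i) ⟧)
      ≡⟨ Σ<-cong d (λ i _ → split i) ⟩
    (Σ< d λ i → ⟦ occurs? (x ∷ v) i ⟧ + ⟦ occurs? (other x ∷ v) i ⟧)
      ≡⟨ Σ<-+ d _ _ ⟩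
    (Σ< d λ i → ⟦ occurs? (x ∷ v) i ⟧) + (Σ< d λ i → ⟦ occurs? (other x ∷ v) i ⟧)
      ≡⟨ cong₂ _+_ (z≡Σ (x ∷ v)) (z≡Σ (other x ∷ v)) ⟨
    z u (x ∷ v) + z u (other x ∷ v)
      ∎
    where
    wrap : ⟦ occurs? v d ⟧ ≡ ⟦ occurs? v 0 ⟧
    wrap = cong (λ w → ⟦ w ≟W v ⟧)
      (segment-≗ s d 0 (length v) λ k _ → trans (cong s (+-comm d k)) (s-period k))

    split : ∀ i → ⟦ occurs? v (suc i) ⟧ ≡ ⟦ occurs? (x ∷ v) i ⟧ + ⟦ occurs? (other x ∷ v) i ⟧
    split i = ⟦⟧-⊎ (occurs? v (suc i)) (occurs? (x ∷ v) i) (occurs? (other x ∷ v) i)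
      (λ occ → Sum.map (λ eq → cong₂ _∷_ eq occ) (λ eq → cong₂ _∷_ eq occ) (x∨other x (s i)))
      ∷-injectiveʳ
      ∷-injectiveʳ
      (λ occ occ′ → x≢other x (trans (sym (∷-injectiveˡ occ)) (∷-injectiveˡ occ′)))

  Sub⇒z>0 : ∀ {v} → Sub u v → 0 < z u v
  Sub⇒z>0 {v} (i , i<d , occ) =
    filter-some (λ i → factor u i (length v) ≟W v) (lose (∈-upTo⁺ i<d) occ)

  z>0⇒Sub : ∀ {v} → 0 < z u v → Sub u v
  z>0⇒Sub {v} z>0
    with filter (λ i → factor u i (length v) ≟W v) (upTo d)
       | (λ {i} → ∈-filter⁻ (λ i → factor u i (length v) ≟W v) {i} {upTo d})
  ... | i ∷ _ | ∈⁻ = i , ∈-upTo⁻ (proj₁ (∈⁻ (here refl))) , proj₂ (∈⁻ (here refl))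

  -- The gcd of `p` and `d` is again a period; it divides `d` and is smaller than `d`, so `u` is a
  -- proper power of its prefix of that length.
  period⇒Periodic : ∀ p → 0 < p → p < d → (∀ k → s (k + p) ≡ s k) → Periodic u
  period⇒Periodic p 0<p p<d per with gcd[m,n]∣n p d
  ... | divides m d≡m*g = segment s 0 g , m , 1<m , u≡pow
    where
    g = gcd p d

    g<d : g < d
    g<d = ≤-<-trans (∣⇒≤ {{≢-nonZero (m<n⇒n≢0 0<p)}} (gcd[m,n]∣m p d)) p<d

    1<m : 1 < m
    1<m = *-cancelʳ-< g 1 m (subst₂ _<_ (sym (*-identityˡ g)) d≡m*g g<d)

    u≡pow : u ≡ pow (segment s 0 g) m
    u≡pow = begin
      u                             ≡⟨ take-all d u ≤-refl ⟨
      take d u                      ≡⟨ take-drop-segment s u 0 d ≤-refl (λ k k<d → cong (letter u) (sym (m<n⇒m%n≡m k<d))) ⟩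
      segment s 0 d                 ≡⟨ cong (segment s 0) d≡m*g ⟩
      segment s 0 (m * g)           ≡⟨ segment-pow s g (period-gcd s p d per s-period) m ⟩
      pow (segment s 0 g) m         ∎

  repeated⇒Periodic : ∀ {i i′} t → d ≤ t → i < i′ → i′ < d → segment s i t ≡ segment s i′ t → Periodic u
  repeated⇒Periodic {i} {i′} t d≤t i<i′ i′<d eq =
    period⇒Periodic p (m<n⇒0<n∸m i<i′) (≤-<-trans (m∸n≤m i′ i) i′<d) per
    where
    p = i′ ∸ i

    -- The equal factors cover at least one full period, so offsets may be reduced modulo `d` to
    -- fall inside them.
    s-reduce : ∀ j k → s (j + k % d) ≡ s (j + k)
    s-reduce j k = begin
      s (j + k % d)                   ≡⟨ period-* s s-period (k / d) (j + k % d) ⟨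
      s (j + k % d + k / d * d)       ≡⟨ cong s (+-assoc j (k % d) _) ⟩
      s (j + (k % d + k / d * d))     ≡⟨ cong (λ n → s (j + n)) (m≡m%n+[m/n]*n k d) ⟨
      s (j + k)                       ∎

    shift : ∀ k → s (i + k) ≡ s (i′ + k)
    shift k = begin
      s (i + k)         ≡⟨ s-reduce i k ⟨
      s (i + k % d)     ≡⟨ segment-injective s i i′ t eq (k % d) (<-≤-trans (m%n<n k d) d≤t) ⟩
      s (i′ + k % d)    ≡⟨ s-reduce i′ k ⟩
      s (i′ + k)        ∎

    -- `shift` speaks of positions from `i` on only; adding a full period `d` first brings every `k`
    -- into that range.
    per : ∀ k → s (k + p) ≡ s k
    per k = begin
      s (k + p)                 ≡⟨ s-period (k + p) ⟨
      s (k + p + d)             ≡⟨ cong s eq₁ ⟨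
      s (i′ + (k + (d ∸ i)))    ≡⟨ shift (k + (d ∸ i)) ⟨
      s (i + (k + (d ∸ i)))     ≡⟨ cong s eq₂ ⟩
      s (k + d)                 ≡⟨ s-period k ⟩
      s k                       ∎
      where
      eq₂ : i + (k + (d ∸ i)) ≡ k + d
      eq₂ = begin
        i + (k + (d ∸ i))     ≡⟨ x∙yz≈y∙xz i k (d ∸ i) ⟩
        k + (i + (d ∸ i))     ≡⟨ cong (k +_) (m+[n∸m]≡n (<⇒≤ (<-trans i<i′ i′<d))) ⟩
        k + d                 ∎
      eq₁ : i′ + (k + (d ∸ i)) ≡ k + p + d
      eq₁ = begin
        i′ + (k + (d ∸ i))          ≡⟨ cong (_+ (k + (d ∸ i))) (m∸n+n≡m (<⇒≤ i<i′)) ⟨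
        p + i + (k + (d ∸ i))       ≡⟨ +-assoc p i _ ⟩
        p + (i + (k + (d ∸ i)))     ≡⟨ cong (p +_) eq₂ ⟩
        p + (k + d)                 ≡⟨ x∙yz≈yx∙z p k d ⟩
        k + p + d                   ∎

  -- Two distinct occurrences of so long a word would force a period shorter than `d`. Primitivity
  -- of `u` enters the proof here.
  z-long : ¬ Periodic u → ∀ v → d ≤ length v → z u v ≤ 1
  z-long ¬per v d≤ = length-filter≤1 (λ i → factor u i (length v) ≟W v) (Unique.upTo⁺ d) unique
    where
    meet : ∀ {i i′} → i < d → OccursAt u i v → i′ < d → OccursAt u i′ v →
           segment s i (length v) ≡ segment s i′ (length v)
    meet {i} {i′} i<d occ i′<d occ′ = begin
      segment s i (length v)    ≡⟨ factor≡segment (length v) i<d ⟨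
      factor u i (length v)     ≡⟨ trans occ (sym occ′) ⟩
      factor u i′ (length v)    ≡⟨ factor≡segment (length v) i′<d ⟩
      segment s i′ (length v)   ∎

    unique : ∀ {i i′} → i ∈ upTo d → OccursAt u i v → i′ ∈ upTo d → OccursAt u i′ v → i ≡ i′
    unique {i} {i′} i∈ occ i′∈ occ′ with <-cmp i i′
    ... | tri≈ _ i≡i′ _ = i≡i′
    ... | tri< i<i′ _ _ = contradiction (repeated⇒Periodic (length v) d≤ i<i′ (∈-upTo⁻ i′∈)
                            (meet (∈-upTo⁻ i∈) occ (∈-upTo⁻ i′∈) occ′)) ¬per
    ... | tri> _ _ i′<i = contradiction (repeated⇒Periodic (length v) d≤ i′<i (∈-upTo⁻ i∈)
                            (meet (∈-upTo⁻ i′∈) occ′ (∈-upTo⁻ i∈) occ)) ¬per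

-- Special words

module Extension (ζ : Word → ℕ)
  (ζ-∷ʳ : ∀ v x → ζ v ≡ ζ (v ∷ʳ x) + ζ (v ∷ʳ other x))
  (ζ-∷  : ∀ v x → ζ v ≡ ζ (x ∷ v) + ζ (other x ∷ v)) where

  open ≤-Reasoning

  ζ-∷ʳ≤ : ∀ v x → ζ (v ∷ʳ x) ≤ ζ v
  ζ-∷ʳ≤ v x = subst (ζ (v ∷ʳ x) ≤_) (sym (ζ-∷ʳ v x)) (m≤m+n _ _)

  ζ-∷≤ : ∀ v x → ζ (x ∷ v) ≤ ζ v
  ζ-∷≤ v x = subst (ζ (x ∷ v) ≤_) (sym (ζ-∷ v x)) (m≤m+n _ _)

  ζ-++≤ˡ : ∀ v w → ζ (v ++ w) ≤ ζ v
  ζ-++≤ˡ v []      = ≤-reflexive (cong ζ (++-identityʳ v))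
  ζ-++≤ˡ v (x ∷ w) = ≤-trans (≤-reflexive (cong ζ (sym (∷ʳ-++ v x w))))
    (≤-trans (ζ-++≤ˡ (v ∷ʳ x) w) (ζ-∷ʳ≤ v x))

  ζ-++≤ʳ : ∀ w v → ζ (w ++ v) ≤ ζ v
  ζ-++≤ʳ []      v = ≤-refl
  ζ-++≤ʳ (x ∷ w) v = ≤-trans (ζ-∷≤ (w ++ v) x) (ζ-++≤ʳ w v)

  RightSpecial LeftSpecial : Word → Set
  RightSpecial v = ∀ x → 0 < ζ (v ∷ʳ x)
  LeftSpecial  v = ∀ x → 0 < ζ (x ∷ v)

  -- The finite forks, with occurrence in the infinite word expressed as positive significance.
  Bispecial : Word → Set
  Bispecial v = LeftSpecial v × RightSpecial v

  -- If the other letter never follows `v`, additivity gives the whole significance of `v` to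
  -- `v ∷ʳ x`.
  rightSpecial? : ∀ v x → 0 < ζ (v ∷ʳ x) → RightSpecial v ⊎ ζ (v ∷ʳ x) ≡ ζ v
  rightSpecial? v x 0<vx with n≡0⊎n>0 (ζ (v ∷ʳ other x))
  ... | inj₁ ≡0 = inj₂ (sym (trans (ζ-∷ʳ v x) (trans (cong (ζ (v ∷ʳ x) +_) ≡0) (+-identityʳ _))))
  ... | inj₂ >0 = inj₁ λ y → [ (λ { refl → 0<vx }) , (λ { refl → >0 }) ]′ (x∨other x y)

  leftSpecial? : ∀ v x → 0 < ζ (x ∷ v) → LeftSpecial v ⊎ ζ (x ∷ v) ≡ ζ v
  leftSpecial? v x 0<xv with n≡0⊎n>0 (ζ (other x ∷ v))
  ... | inj₁ ≡0 = inj₂ (sym (trans (ζ-∷ v x) (trans (cong (ζ (x ∷ v) +_) ≡0) (+-identityʳ _))))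
  ... | inj₂ >0 = inj₁ λ y → [ (λ { refl → 0<xv }) , (λ { refl → >0 }) ]′ (x∨other x y)

  -- If every occurrence of `v` is preceded by `w`, so is every occurrence of `v ∷ʳ x`: the two
  -- summands on one side are bounded by those on the other, and the sums agree.
  ζ-++-∷ : ∀ w v → ζ (w ++ v) ≡ ζ v → ∀ x → ζ ((w ++ v) ∷ʳ x) ≡ ζ (v ∷ʳ x)
  ζ-++-∷ w v eq x = +-squeeze (bound x) (bound (other x)) (begin-equality
    ζ ((w ++ v) ∷ʳ x) + ζ ((w ++ v) ∷ʳ other x)   ≡⟨ ζ-∷ʳ (w ++ v) x ⟨
    ζ (w ++ v)                                      ≡⟨ eq ⟩
    ζ v                                             ≡⟨ ζ-∷ʳ v x ⟩
    ζ (v ∷ʳ x) + ζ (v ∷ʳ other x)                 ∎)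
    where
    bound : ∀ y → ζ ((w ++ v) ∷ʳ y) ≤ ζ (v ∷ʳ y)
    bound y = subst (λ t → ζ t ≤ ζ (v ∷ʳ y)) (sym (++-assoc w v [ y ])) (ζ-++≤ʳ w (v ∷ʳ y))

  ζ-∷-++ : ∀ v w → ζ (v ++ w) ≡ ζ v → ∀ x → ζ (x ∷ v ++ w) ≡ ζ (x ∷ v)
  ζ-∷-++ v w eq x = +-squeeze (ζ-++≤ˡ (x ∷ v) w) (ζ-++≤ˡ (other x ∷ v) w) (begin-equality
    ζ (x ∷ v ++ w) + ζ (other x ∷ v ++ w)   ≡⟨ ζ-∷ (v ++ w) x ⟨
    ζ (v ++ w)                                ≡⟨ eq ⟩
    ζ v                                       ≡⟨ ζ-∷ v x ⟩
    ζ (x ∷ v) + ζ (other x ∷ v)             ∎)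

  rightSpecial⇒1<ζ : ∀ v → RightSpecial v → 1 < ζ v
  rightSpecial⇒1<ζ v r = subst (1 <_) (sym (ζ-∷ʳ v a)) (+-mono-≤ (r a) (r b))

  -- A proper prefix of `F` longer than `G` is left special, because `F` is. Were it right special
  -- too, it would be a fork contradicting the choice of `G`. So each further letter up to `F` is
  -- forced and the significance stays constant.
  longest-prefix-ζ : ∀ {F} → Bispecial F → ∀ G x S → G ++ x ∷ S ≡ F →
    (∀ H → ProperPrefix H F → Bispecial H → length H ≤ length G) → ζ (G ∷ʳ x) ≡ ζ F
  longest-prefix-ζ {F} bispecialF G x S G++xS≡F longest = rigid S (G ∷ʳ x) (trans (∷ʳ-++ G x S) G++xS≡F)
    (≤-reflexive (sym (trans (length-++ G) (+-comm (length G) 1))))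
    where
    rigid : ∀ T H → H ++ T ≡ F → length G < length H → ζ H ≡ ζ F
    rigid []      H H++[]≡F _ = cong ζ (trans (sym (++-identityʳ H)) H++[]≡F)
    rigid (y ∷ T) H H++yT≡F G<H with rightSpecial? H y
      (<-≤-trans (<-trans z<s (rightSpecial⇒1<ζ F (proj₂ bispecialF)))
        (subst (λ t → ζ t ≤ ζ (H ∷ʳ y)) (trans (∷ʳ-++ H y T) H++yT≡F) (ζ-++≤ˡ (H ∷ʳ y) T)))
    ... | inj₂ eq = trans (sym eq) (rigid T (H ∷ʳ y) (trans (∷ʳ-++ H y T) H++yT≡F)
                      (subst (length G <_) (sym (length-++ H)) (<-≤-trans G<H (m≤m+n _ _))))
    ... | inj₁ rightSpecial = contradiction
      (longest H (y ∷ T , (λ ()) , H++yT≡F) (leftSpecial , rightSpecial)) (<⇒≱ G<H)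
      where
      leftSpecial : LeftSpecial H
      leftSpecial c = <-≤-trans (proj₁ bispecialF c)
        (subst (λ t → ζ (c ∷ t) ≤ ζ (c ∷ H)) H++yT≡F (ζ-++≤ˡ (c ∷ H) (y ∷ T)))

  -- Extension of words to forks of the same significance

  module _ (d : ℕ) (ζ-long : ∀ v → d ≤ length v → ζ v ≤ 1) where

    1<ζ⇒short : ∀ v → 1 < ζ v → length v < d
    1<ζ⇒short v 1<ζ with d ≤? length v
    ... | yes d≤ = contradiction (ζ-long v d≤) (<⇒≱ 1<ζ)
    ... | no  d≰ = ≰⇒> d≰

    -- While only one letter can follow, appending it keeps the significance. The fuel `m` suffices,
    -- since a word of length at least `d` has significance at most 1.
    extend-right : ∀ m v → d ≤ m + length v → 1 < ζ v → ∃ λ w → RightSpecial (v ++ w) × ζ (v ++ w) ≡ ζ v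
    extend-right zero    v d≤ 1<ζ = contradiction d≤ (<⇒≱ (1<ζ⇒short v 1<ζ))
    extend-right (suc m) v d≤ 1<ζ = step (n≡0⊎n>0 (ζ (v ∷ʳ a)))
      where
      grow : ∀ x → ζ (v ∷ʳ x) ≡ ζ v → ∃ λ w → RightSpecial (v ++ w) × ζ (v ++ w) ≡ ζ v
      grow x eq with extend-right m (v ∷ʳ x)
        (subst (d ≤_) (trans (sym (+-suc m _)) (cong (m +_) (trans (+-comm 1 _) (sym (length-++ v))))) d≤)
        (subst (1 <_) (sym eq) 1<ζ)
      ... | w , special , eq′ = x ∷ w
        , subst RightSpecial (∷ʳ-++ v x w) special
        , trans (cong ζ (sym (∷ʳ-++ v x w))) (trans eq′ eq)

      step : ζ (v ∷ʳ a) ≡ 0 ⊎ 0 < ζ (v ∷ʳ a) → ∃ λ w → RightSpecial (v ++ w) × ζ (v ++ w) ≡ ζ v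
      step (inj₁ ≡0) = grow b (sym (trans (ζ-∷ʳ v a) (cong (_+ ζ (v ∷ʳ b)) ≡0)))
      step (inj₂ >0) with rightSpecial? v a >0
      ... | inj₂ eq      = grow a eq
      ... | inj₁ special = [] , subst RightSpecial (sym (++-identityʳ v)) special , cong ζ (++-identityʳ v)

    extend-left : ∀ m v → d ≤ m + length v → 1 < ζ v → ∃ λ w → LeftSpecial (w ++ v) × ζ (w ++ v) ≡ ζ v
    extend-left zero    v d≤ 1<ζ = contradiction d≤ (<⇒≱ (1<ζ⇒short v 1<ζ))
    extend-left (suc m) v d≤ 1<ζ = step (n≡0⊎n>0 (ζ (a ∷ v)))
      where
      grow : ∀ x → ζ (x ∷ v) ≡ ζ v → ∃ λ w → LeftSpecial (w ++ v) × ζ (w ++ v) ≡ ζ v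
      grow x eq with extend-left m (x ∷ v) (subst (d ≤_) (sym (+-suc m _)) d≤) (subst (1 <_) (sym eq) 1<ζ)
      ... | w , special , eq′ = w ∷ʳ x
        , subst LeftSpecial (sym (∷ʳ-++ w x v)) special
        , trans (cong ζ (∷ʳ-++ w x v)) (trans eq′ eq)

      step : ζ (a ∷ v) ≡ 0 ⊎ 0 < ζ (a ∷ v) → ∃ λ w → LeftSpecial (w ++ v) × ζ (w ++ v) ≡ ζ v
      step (inj₁ ≡0) = grow b (sym (trans (ζ-∷ v a) (cong (_+ ζ (b ∷ v)) ≡0)))
      step (inj₂ >0) with leftSpecial? v a >0
      ... | inj₂ eq      = grow a eq
      ... | inj₁ special = [] , special , refl

    -- A left extension that loses no occurrence keeps the significances of both right extensions,
    -- hence right specialness.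
    left-closure : ∀ v → RightSpecial v → ∃ λ w → Bispecial (w ++ v) × ζ (w ++ v) ≡ ζ v
    left-closure v special with extend-left d v (m≤m+n d _) (rightSpecial⇒1<ζ v special)
    ... | w , left , eq = w , (left , λ x → subst (0 <_) (sym (ζ-++-∷ w v eq x)) (special x)) , eq

    closure : ∀ v → 1 < ζ v → ∃ λ w → Bispecial w × ζ w ≡ ζ v
    closure v 1<ζ with extend-right d v (m≤m+n d _) 1<ζ
    ... | w , right , eq with left-closure (v ++ w) right
    ... | w′ , fork , eq′ = w′ ++ v ++ w , fork , trans eq′ eq

    -- The sequence of significances and its exceptional indices

    module Enumerated (n : ℕ) (v : ℕ → Fork) (σ : ℕ → ℕ)
      (σ-0       : σ 0 ≡ 1)
      (σ-fin     : ∀ {i w} → v i ≡ fin w → σ i ≡ ζ w)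
      (σ-mono    : ∀ {i j} → i ≤ j → j ≤ n → σ i ≤ σ j)
      (finite    : ∀ {i} → 0 < i → i ≤ n → ∃ λ w → v i ≡ fin w)
      (bispecial : ∀ {i w} → i ≤ n → v i ≡ fin w → Bispecial w)
      (index     : ∀ {w} → Bispecial w → ∃ λ i → i ≤ n × v i ≡ fin w)
      where

      Exc : ℕ → Set
      Exc i = 2 ≤ i × i ≤ n × σ (i ∸ 1) + σ (i ∸ 2) < σ i

      exc? : ∀ i → Dec (Exc i)
      exc? i = 2 ≤? i ×-dec i ≤? n ×-dec σ (i ∸ 1) + σ (i ∸ 2) <? σ i

      -- The given index function takes a proof of exceptionality as an argument; its value must not
      -- depend on which proof.
      exc-irrelevant : ∀ {i} (e e′ : Exc i) → e ≡ e′
      exc-irrelevant (x , y , w) (x′ , y′ , w′) =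
        cong₂ _,_ (≤-irrelevant x x′) (cong₂ _,_ (≤-irrelevant y y′) (≤-irrelevant w w′))

      σ-cancel-< : ∀ {i j} → i ≤ n → σ i < σ j → i < j
      σ-cancel-< i≤n σi<σj = ≰⇒> λ j≤i → <⇒≱ σi<σj (σ-mono j≤i i≤n)

      -- The value 1 is attained by the infinite word at index 0, every larger value by the fork
      -- that closes `w`.
      σ-index : ∀ w → 0 < ζ w → ∃ λ i → i ≤ n × σ i ≡ ζ w
      σ-index w 0<ζw with m≤n⇒m<n∨m≡n 0<ζw
      ... | inj₂ 1≡ζw = 0 , z≤n , trans σ-0 1≡ζw
      ... | inj₁ 1<ζw with closure w 1<ζw
      ... | w′ , bi , eq with index bi
      ... | i , i≤n , vi≡ = i , i≤n , trans (σ-fin vi≡) eq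

      below : ∀ {i} w → 0 < ζ w → ζ w < σ (suc i) → suc i ≤ n → ζ w ≤ σ i
      below w 0<ζw ζw< i<n with σ-index w 0<ζw
      ... | m , m≤n , σm≡ = subst (_≤ _) σm≡
        (σ-mono (s≤s⁻¹ (σ-cancel-< m≤n (subst (_< _) (sym σm≡) ζw<))) (<⇒≤ i<n))

      ζ-∷ʳ< : ∀ {i w} x → i ≤ n → v i ≡ fin w → ζ (w ∷ʳ x) < σ i
      ζ-∷ʳ< {i} {w} x i≤n vi≡ = subst (ζ (w ∷ʳ x) <_) (sym (trans (σ-fin vi≡) (ζ-∷ʳ w x)))
        (m<m+n _ (proj₂ (bispecial i≤n vi≡) (other x)))

      ζ-∷< : ∀ {i w} x → i ≤ n → v i ≡ fin w → ζ (x ∷ w) < σ i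
      ζ-∷< {i} {w} x i≤n vi≡ = subst (ζ (x ∷ w) <_) (sym (trans (σ-fin vi≡) (ζ-∷ w x)))
        (m<m+n _ (proj₁ (bispecial i≤n vi≡) (other x)))

      -- The extension by the other letter is nonempty and strictly less significant than the fork,
      -- so its significance already occurs at an index up to `i`.
      σ-∷ʳ≤ : ∀ {i w} x → suc i ≤ n → v (suc i) ≡ fin w → σ (suc i) ≤ σ i + ζ (w ∷ʳ x)
      σ-∷ʳ≤ {i} {w} x i<n vi≡ = begin
        σ (suc i)                          ≡⟨ trans (σ-fin vi≡) (ζ-∷ʳ w x) ⟩
        ζ (w ∷ʳ x) + ζ (w ∷ʳ other x)      ≡⟨ +-comm (ζ (w ∷ʳ x)) _ ⟩
        ζ (w ∷ʳ other x) + ζ (w ∷ʳ x)      ≤⟨ +-monoˡ-≤ _ (below (w ∷ʳ other x) (proj₂ (bispecial i<n vi≡) (other x)) (ζ-∷ʳ< (other x) i<n vi≡) i<n) ⟩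
        σ i + ζ (w ∷ʳ x)                   ∎

      -- Both right extensions have a significance that occurs in the sequence before σ (2 + p) and is larger than σ p.
      exc-∷ʳ : ∀ {p w} → Exc (2 + p) → v (2 + p) ≡ fin w → ∀ x → ζ (w ∷ʳ x) ≡ σ (1 + p)
      exc-∷ʳ {p} {w} (_ , i≤n , exc) vi≡ x = ≤-antisym (upper x) (≮⇒≥ λ ζ< →
        <⇒≱ (begin-strict
          σ (1 + p) + σ p                     <⟨ exc ⟩
          σ (2 + p)                           ≡⟨ trans (σ-fin vi≡) (ζ-∷ʳ w x) ⟩
          ζ (w ∷ʳ x) + ζ (w ∷ʳ other x)       ≤⟨ +-mono-≤ (below (w ∷ʳ x) (special x) ζ< (<⇒≤ i≤n)) (upper (other x)) ⟩
          σ p + σ (1 + p)                     ≡⟨ +-comm (σ p) _ ⟩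
          σ (1 + p) + σ p                     ∎) ≤-refl)
        where
        special = proj₂ (bispecial i≤n vi≡)
        upper : ∀ y → ζ (w ∷ʳ y) ≤ σ (1 + p)
        upper y = below (w ∷ʳ y) (special y) (ζ-∷ʳ< y i≤n vi≡) i≤n

      exc-double : ∀ {p} → Exc (2 + p) → σ (2 + p) ≡ σ (1 + p) + σ (1 + p)
      exc-double {p} e@(_ , i≤n , _) with finite z<s i≤n
      ... | w , vi≡ = trans (σ-fin vi≡) (trans (ζ-∷ʳ w a) (cong₂ _+_ (exc-∷ʳ e vi≡ a) (exc-∷ʳ e vi≡ b)))

      exc-< : ∀ {p} → Exc (2 + p) → σ p < σ (1 + p)
      exc-< {p} e@(_ , _ , exc) = +-cancelˡ-< (σ (1 + p)) _ _ (subst (σ (1 + p) + σ p <_) (exc-double e) exc)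

      exc-pred-< : ∀ {p} → Exc (2 + p) → σ (1 + p) < σ (2 + p)
      exc-pred-< {p} (_ , _ , exc) = ≤-<-trans (m≤m+n _ _) exc

      -- The data used about Ψ of the exceptional fork with index `2 + p`: `F` is the preceding
      -- fork, `G` its prefix fork with index `j`, and `x` the letter after `G` in `F`. Maximality
      -- of `G` survives only through `ζGx`.
      record Psi (p j : ℕ) : Set where
        field
          {F G}   : Word
          {x}     : Letter
          {S}     : Word
          j≤n     : j ≤ n
          vF      : v (1 + p) ≡ fin F
          vG      : v j ≡ fin G
          F≡GxS   : G ++ x ∷ S ≡ F
          ζGx     : ζ (G ∷ʳ x) ≡ σ (1 + p)

        σj≡ : σ j ≡ ζ (a ∷ G) + ζ (b ∷ G)
        σj≡ = trans (σ-fin vG) (ζ-∷ G a)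

        pred<j : 1 + p ≤ n → 1 + p < j
        pred<j p<n = σ-cancel-< p<n (subst (_< σ j) ζGx (ζ-∷ʳ< x j≤n vG))

        -- Every occurrence of G x extends to one of F, hence so does every occurrence of c G x to one of c F.
        ζcGx : ∀ c → ζ ((c ∷ G) ∷ʳ x) ≡ ζ (c ∷ F)
        ζcGx c = trans (sym (ζ-∷-++ (G ∷ʳ x) S GxS≡Gx c)) (cong (λ w → ζ (c ∷ w)) GxS≡F)
          where
          GxS≡F : (G ∷ʳ x) ++ S ≡ F
          GxS≡F = trans (∷ʳ-++ G x S) F≡GxS
          GxS≡Gx : ζ ((G ∷ʳ x) ++ S) ≡ ζ (G ∷ʳ x)
          GxS≡Gx = trans (cong ζ GxS≡F) (trans (sym (σ-fin vF)) (sym ζGx))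

        extension : ∀ c → Exc (2 + p) → σ (1 + p) ≤ ζ (c ∷ G) →
          ∃ λ w → Bispecial (w ++ c ∷ G) × ζ (w ++ c ∷ G) ≡ ζ (c ∷ G) × ζ ((w ++ c ∷ G) ∷ʳ x) ≤ σ p
        extension c (_ , i≤n , _) σ≤ζcG =
          let w , bi , eq = left-closure (c ∷ G) rightSpecial
          in w , bi , eq , subst (_≤ σ p) (sym (trans (ζ-++-∷ w (c ∷ G) eq x) (ζcGx c)))
                             (below (c ∷ F) 0<ζcF ζcF< (<⇒≤ i≤n))
          where
          0<ζcF : 0 < ζ (c ∷ F)
          0<ζcF = proj₁ (bispecial (<⇒≤ i≤n) vF) c
          ζcF< : ζ (c ∷ F) < σ (1 + p)
          ζcF< = ζ-∷< c (<⇒≤ i≤n) vF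
          -- The letter `x` can follow `c ∷ G`, but not after every occurrence, since `ζ (c ∷ F)` is
          -- too small.
          rightSpecial : RightSpecial (c ∷ G)
          rightSpecial with rightSpecial? (c ∷ G) x (subst (0 <_) (sym (ζcGx c)) 0<ζcF)
          ... | inj₁ special = special
          ... | inj₂ eq      = contradiction (trans (sym (ζcGx c)) eq) (<⇒≢ (<-≤-trans ζcF< σ≤ζcG))

      -- The index that needs a `k` is `2 + p`, whereas `G` comes from a possibly earlier
      -- exceptional index `2 + q`. This generality serves the repeated search; it starts with `q`
      -- equal to `p`.
      module _ {p q j} (exc-i : Exc (2 + p)) (exc-e : Exc (2 + q)) (q≤p : q ≤ p) (i≤j : 2 + p ≤ j) (Ψ : Psi q j) where
        open Psi Ψ

        private
          i≤n : 2 + p ≤ n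
          i≤n = proj₁ (proj₂ exc-i)

        Between : Set
        Between = ∃ λ k → (2 + p < k × k < j) × ∃ λ K → v k ≡ fin K × ζ (K ∷ʳ x) ≤ σ q

        -- The fork closing `c ∷ G` to the left has index above `p` and below `j`. Index `2 + p` is
        -- ruled out by its small right extension, so the only alternative to success is index
        -- `1 + p`.
        candidate : ∀ c → σ (1 + p) ≤ ζ (c ∷ G) →
                    (∃ λ w → v (1 + p) ≡ fin (w ++ c ∷ G)) × σ (1 + p) ≡ ζ (c ∷ G) ⊎ Between
        candidate c σ≤ζcG with extension c exc-e (≤-trans (σ-mono (s≤s q≤p) (<⇒≤ i≤n)) σ≤ζcG)
        ... | w , bi , eq , small with index bi
        ... | k , k≤n , vk = locate (m≤n⇒m<n∨m≡n p<k)
          where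
          σk : σ k ≡ ζ (c ∷ G)
          σk = trans (σ-fin vk) eq

          k<j : k < j
          k<j = σ-cancel-< k≤n (subst (_< σ j) (sym σk) (ζ-∷< c j≤n vG))

          p<k : p < k
          p<k = σ-cancel-< (<⇒≤ (<⇒≤ i≤n)) (<-≤-trans (exc-< exc-i) (≤-trans σ≤ζcG (≤-reflexive (sym σk))))

          locate : 1 + p < k ⊎ 1 + p ≡ k →
                   (∃ λ w → v (1 + p) ≡ fin (w ++ c ∷ G)) × σ (1 + p) ≡ ζ (c ∷ G) ⊎ Between
          locate (inj₂ 1+p≡k) = inj₁ ((w , trans (cong v 1+p≡k) vk) , trans (cong σ 1+p≡k) σk)
          locate (inj₁ 1+p<k) with m≤n⇒m<n∨m≡n 1+p<k
          ... | inj₁ i<k = inj₂ (k , (i<k , k<j) , w ++ c ∷ G , vk , small)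
          -- Both right extensions of an exceptional fork have significance `σ (1 + p)`, which
          -- exceeds the bound `σ q`.
          ... | inj₂ i≡k = contradiction small (<⇒≱ (begin-strict
            σ q                             ≤⟨ σ-mono q≤p (<⇒≤ (<⇒≤ i≤n)) ⟩
            σ p                             <⟨ exc-< exc-i ⟩
            σ (1 + p)                       ≡⟨ exc-∷ʳ exc-i (trans (cong v i≡k) vk) x ⟨
            ζ ((w ++ c ∷ G) ∷ʳ x)           ∎))

        Σ≤ζaG+ζbG : σ (1 + p) + σ (1 + p) ≤ ζ (a ∷ G) + ζ (b ∷ G)
        Σ≤ζaG+ζbG = begin
          σ (1 + p) + σ (1 + p)          ≡⟨ exc-double exc-i ⟨
          σ (2 + p)                      ≤⟨ σ-mono i≤j j≤n ⟩
          σ j                            ≡⟨ σj≡ ⟩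
          ζ (a ∷ G) + ζ (b ∷ G)          ∎

        -- The candidates for a and b cannot both be v (1 + p), as they end in different words.
        between : Between
        between with σ (1 + p) ≤? ζ (a ∷ G)
        ... | yes σ≤ζaG = first (candidate a σ≤ζaG)
          where
          second : ∀ w → v (1 + p) ≡ fin (w ++ a ∷ G) →
                   (∃ λ w → v (1 + p) ≡ fin (w ++ b ∷ G)) × σ (1 + p) ≡ ζ (b ∷ G) ⊎ Between → Between
          second w vp≡ (inj₂ found)             = found
          second w vp≡ (inj₁ ((w′ , vp≡′) , _)) =
            contradiction (trans (sym vp≡) vp≡′) (fin-++-≢ w w′ G λ ())

          first : (∃ λ w → v (1 + p) ≡ fin (w ++ a ∷ G)) × σ (1 + p) ≡ ζ (a ∷ G) ⊎ Between → Between
          first (inj₂ found)               = found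
          -- As `a ∷ G` takes exactly `σ (1 + p)` of a total of at least twice that, `b ∷ G` is
          -- significant enough as well.
          first (inj₁ ((w , vp≡) , σ≡ζaG)) = second w vp≡ (candidate b
            (+-cancelˡ-≤ (σ (1 + p)) _ _ (subst (λ t → σ (1 + p) + σ (1 + p) ≤ t + ζ (b ∷ G)) (sym σ≡ζaG) Σ≤ζaG+ζbG)))
        ... | no  σ≰ζaG = settle (candidate b (<⇒≤ σ<ζbG))
          where
          -- Here `b ∷ G` must take strictly more than half, so its closure cannot be `v (1 + p)`.
          σ<ζbG : σ (1 + p) < ζ (b ∷ G)
          σ<ζbG = +-cancelˡ-< (σ (1 + p)) _ _ (≤-<-trans Σ≤ζaG+ζbG (+-monoˡ-< _ (≰⇒> σ≰ζaG)))

          settle : (∃ λ w → v (1 + p) ≡ fin (w ++ b ∷ G)) × σ (1 + p) ≡ ζ (b ∷ G) ⊎ Between → Between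
          settle (inj₁ (_ , σ≡ζbG)) = contradiction σ≡ζbG (<⇒≢ σ<ζbG)
          settle (inj₂ found)       = found

      -- Inequalities, regularity and distinctness of the indices

      psi-bound : ∀ {p j} → 1 + p ≤ n → Psi p j → σ j ≤ σ (j ∸ 1) + σ (1 + p)
      psi-bound {j = zero}  p<n Ψ = contradiction (Psi.pred<j Ψ p<n) λ ()
      psi-bound {j = suc j} p<n Ψ = subst (λ t → σ (suc j) ≤ σ j + t) ζGx (σ-∷ʳ≤ x j≤n vG)
        where open Psi Ψ

      -- Were `k` exceptional, both right extensions of its fork would have the significance at
      -- `k ∸ 1`, which is at least `σ (2 + p)` and so exceeds `σ (1 + p)`. Applied to the indices
      -- `j` and `k` alike.
      narrow⇒regular : ∀ {p k K} → Exc (2 + p) → 2 + p < k → v k ≡ fin K → ∀ x → ζ (K ∷ʳ x) ≤ σ (1 + p) → ¬ Exc k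
      narrow⇒regular {p} {suc (suc r)} {K} exc-i (s≤s i≤r) vk x narrow exc-k@(_ , k≤n , _) = <⇒≱ (begin-strict
        σ (1 + p)        <⟨ exc-pred-< exc-i ⟩
        σ (2 + p)        ≤⟨ σ-mono i≤r (<⇒≤ k≤n) ⟩
        σ (1 + r)        ≡⟨ exc-∷ʳ exc-k vk x ⟨
        ζ (K ∷ʳ x)       ∎) narrow

      ζ-psi : ∀ {p j K} (Ψ : Psi p j) → v j ≡ fin K → ζ (K ∷ʳ Psi.x Ψ) ≡ σ (1 + p)
      ζ-psi Ψ vj = trans (cong (λ w → ζ (w ∷ʳ x)) (fin-injective (trans (sym vj) vG))) ζGx
        where open Psi Ψ

      -- If both prefixes continue with the same letter, one word gets two significances. If the
      -- letters differ, `σ j` is `σ (1 + p) + σ (1 + p′)`, less than twice `σ (1 + p′)`, that is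
      -- `σ (2 + p′)`, although `2 + p′` is at most `j`.
      psi-injective< : ∀ {p p′ j} → Exc (2 + p) → Exc (2 + p′) → p < p′ → Psi p j → ¬ Psi p′ j
      psi-injective< {p} {p′} {j} e e′@(_ , i′≤n , _) p<p′ Ψ Ψ′ with x∨other (Psi.x Ψ) (Psi.x Ψ′)
      ... | inj₁ x′≡x = <⇒≢ σ<σ′ (trans (sym (Psi.ζGx Ψ))
              (trans (cong (λ y → ζ (Psi.G Ψ ∷ʳ y)) (sym x′≡x)) (ζ-psi Ψ′ (Psi.vG Ψ))))
        where
        σ<σ′ : σ (1 + p) < σ (1 + p′)
        σ<σ′ = <-≤-trans (exc-pred-< e) (σ-mono (s≤s p<p′) (<⇒≤ i′≤n))
      ... | inj₂ x′≡other = <⇒≱ (begin-strict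
        σ j                                            ≡⟨ trans (σ-fin vG) (ζ-∷ʳ G x) ⟩
        ζ (G ∷ʳ x) + ζ (G ∷ʳ other x)                  ≡⟨ cong₂ _+_ ζGx (trans (cong (λ y → ζ (G ∷ʳ y)) (sym x′≡other)) (ζ-psi Ψ′ vG)) ⟩
        σ (1 + p) + σ (1 + p′)                         <⟨ +-monoˡ-< (σ (1 + p′)) (<-≤-trans (exc-pred-< e) (σ-mono (s≤s p<p′) (<⇒≤ i′≤n))) ⟩
        σ (1 + p′) + σ (1 + p′)                        ≡⟨ exc-double e′ ⟨
        σ (2 + p′)                                     ∎) (σ-mono (Psi.pred<j Ψ′ (<⇒≤ i′≤n)) j≤n)
        where open Psi Ψ

      -- Whichever letter continues `K` in the second prefix, `σ (1 + q′)` is at most `σ q`: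
      -- directly if it is `x`, and otherwise because `σ k` is at least twice `σ (1 + q′)`, which
      -- leaves at least that much for `K ∷ʳ x`.
      psi-descent : ∀ {q q′ k K} → Exc (2 + q) → Exc (2 + q′) → v k ≡ fin K → ∀ x → ζ (K ∷ʳ x) ≤ σ q → Psi q′ k → q′ < q
      psi-descent {q} {q′} {k} {K} e e′@(_ , i′≤n , _) vk x narrow Ψ = ≰⇒> λ q≤q′ →
        <⇒≱ (exc-< e) (≤-trans (σ-mono (s≤s q≤q′) (<⇒≤ i′≤n)) (σ′≤ (x∨other x (Psi.x Ψ))))
        where
        σ′≤ : Psi.x Ψ ≡ x ⊎ Psi.x Ψ ≡ other x → σ (1 + q′) ≤ σ q
        σ′≤ (inj₁ ≡x)     = subst (_≤ σ q) (trans (cong (λ y → ζ (K ∷ʳ y)) (sym ≡x)) (ζ-psi Ψ vk)) narrow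
        σ′≤ (inj₂ ≡other) = ≤-trans (+-cancelʳ-≤ (σ (1 + q′)) _ _ (begin
          σ (1 + q′) + σ (1 + q′)           ≡⟨ exc-double e′ ⟨
          σ (2 + q′)                        ≤⟨ σ-mono (Psi.pred<j Ψ (<⇒≤ i′≤n)) (Psi.j≤n Ψ) ⟩
          σ k                               ≡⟨ trans (σ-fin vk) (ζ-∷ʳ K x) ⟩
          ζ (K ∷ʳ x) + ζ (K ∷ʳ other x)     ≡⟨ cong (ζ (K ∷ʳ x) +_) (trans (cong (λ y → ζ (K ∷ʳ y)) (sym ≡other)) (ζ-psi Ψ vk)) ⟩
          ζ (K ∷ʳ x) + σ (1 + q′)           ∎)) narrow

      -- Choice of the indices k

      module Indices (j : ∀ i → Exc i → ℕ) (ψ : ∀ p (e : Exc (2 + p)) → Psi p (j (2 + p) e)) where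

        IsJ : ℕ → ℕ → Set
        IsJ k i = Σ (Exc i) λ e → k ≡ j i e

        isJ? : ∀ k i → Dec (IsJ k i)
        isJ? k i with exc? i
        ... | no ¬e = no (¬e ∘ proj₁)
        ... | yes e with k ≟ j i e
        ...   | yes k≡j = yes (e , k≡j)
        ...   | no  k≢j = no λ (e′ , k≡j) → k≢j (trans k≡j (cong (j i) (exc-irrelevant e′ e)))

        record IsK (p k : ℕ) : Set where
          field
            i<k     : 2 + p < k
            bound   : σ k ≤ σ (k ∸ 1) + σ p
            regular : ¬ Exc k
            notJ    : ∀ i (e : Exc i) → k ≢ j i e

        -- If the fork k found below j (2 + q) is itself some j (2 + q′), then q′ < q and the search restarts below k.
        search : ∀ {p q} → Exc (2 + p) → (e : Exc (2 + q)) → Acc _<_ q → q ≤ p → 2 + p ≤ j (2 + q) e →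
                 ∃ λ k → k < j (2 + q) e × IsK p k
        search {p} {q} exc-i e (acc rec) q≤p i≤j with between exc-i e q≤p i≤j (ψ q e)
        ... | k , (i<k , k<j) , K , vk , narrow with anyUpTo? (isJ? k) (suc n)
        ...   | yes (suc (suc q′) , _ , e′ , refl) =
          let q′<q = psi-descent e e′ vk (Psi.x (ψ q e)) narrow (ψ q′ e′)
              k′ , k′<k , isK = search exc-i e′ (rec q′<q) (≤-trans (<⇒≤ q′<q) q≤p) (<⇒≤ i<k)
          in k′ , <-trans k′<k k<j , isK
        ...   | yes (zero , _ , (() , _) , _)
        ...   | yes (suc zero , _ , (s≤s () , _) , _)
        ...   | no ¬isJ = k , k<j , record
          { i<k     = i<k
          ; bound   = bound k i<k k<j vk narrow
          ; regular = narrow⇒regular exc-i i<k vk (Psi.x (ψ q e))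
                        (≤-trans narrow (σ-mono (≤-trans q≤p (n≤1+n p)) (<⇒≤ (proj₁ (proj₂ exc-i)))))
          ; notJ    = λ i e′ k≡j → ¬isJ (i , s≤s (proj₁ (proj₂ e′)) , e′ , k≡j)
          }
          where
          bound : ∀ k → 2 + p < k → k < j (2 + q) e → v k ≡ fin K → ζ (K ∷ʳ Psi.x (ψ q e)) ≤ σ q →
                  σ k ≤ σ (k ∸ 1) + σ p
          bound (suc k) _ k<j vk narrow = ≤-trans (σ-∷ʳ≤ (Psi.x (ψ q e)) (≤-trans (<⇒≤ k<j) (Psi.j≤n (ψ q e))) vk)
            (+-monoʳ-≤ (σ k) (≤-trans narrow (σ-mono q≤p (<⇒≤ (<⇒≤ (proj₁ (proj₂ exc-i)))))))

        select : ∀ {p} (e : Exc (2 + p)) → ∃ λ k → k < j (2 + p) e × IsK p k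
        select {p} e = search e e (<-wellFounded p) ≤-refl (Psi.pred<j (ψ p e) (<⇒≤ (proj₁ (proj₂ e))))

        j-bound : ∀ {p} (e : Exc (2 + p)) → σ (j (2 + p) e) ≤ σ (j (2 + p) e ∸ 1) + σ (1 + p)
        j-bound {p} e = psi-bound (<⇒≤ (proj₁ (proj₂ e))) (ψ p e)

        j-regular : ∀ {p} (e : Exc (2 + p)) → ¬ Exc (j (2 + p) e)
        j-regular {p} e with select e
        ... | k , k<j , isK = narrow⇒regular e (<-trans (IsK.i<k isK) k<j) (Psi.vG (ψ p e)) (Psi.x (ψ p e))
          (≤-reflexive (Psi.ζGx (ψ p e)))

        j-injective : ∀ {p p′} (e : Exc (2 + p)) (e′ : Exc (2 + p′)) → p ≢ p′ → j (2 + p) e ≢ j (2 + p′) e′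
        j-injective {p} {p′} e e′ p≢p′ j≡j′ with <-cmp p p′
        ... | tri< p<p′ _ _ = psi-injective< e e′ p<p′ (subst (Psi p) j≡j′ (ψ p e)) (ψ p′ e′)
        ... | tri≈ _ p≡p′ _ = p≢p′ p≡p′
        ... | tri> _ _ p′<p = psi-injective< e′ e p′<p (subst (Psi p′) (sym j≡j′) (ψ p′ e′)) (ψ p e)

module ForkSequence (u : Word) (u≢[] : u ≢ []) (¬per : ¬ Periodic u) (n : ℕ) (E : ForkEnumeration u n) where

  open Significance u u≢[]

  abstract
    ζ : Word → ℕ
    ζ = z u

    z≡ζ : ∀ w → z u w ≡ ζ w
    z≡ζ w = refl

    ζ-∷ʳ : ∀ w x → ζ w ≡ ζ (w ∷ʳ x) + ζ (w ∷ʳ other x)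
    ζ-∷ʳ = z-∷ʳ

    ζ-∷ : ∀ w x → ζ w ≡ ζ (x ∷ w) + ζ (other x ∷ w)
    ζ-∷ = z-∷

    ζ-long : ∀ w → length u ≤ length w → ζ w ≤ 1
    ζ-long = z-long ¬per

    ζ>0⇒Sub : ∀ {w} → 0 < ζ w → Sub u w
    ζ>0⇒Sub = z>0⇒Sub

    Sub⇒ζ>0 : ∀ {w} → Sub u w → 0 < ζ w
    Sub⇒ζ>0 = Sub⇒z>0

  open Extension ζ ζ-∷ʳ ζ-∷
  open ForkEnumeration E renaming (v to forks; mono to zs-mono; first to forks-0)

  bispecial⇒fork : ∀ {w} → Bispecial w → IsFork u (fin w)
  bispecial⇒fork (l , r) = ζ>0⇒Sub (r a) , ζ>0⇒Sub (r b) , ζ>0⇒Sub (l a) , ζ>0⇒Sub (l b)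

  fork⇒bispecial : ∀ {w} → IsFork u (fin w) → Bispecial w
  fork⇒bispecial {w} (wa , wb , aw , bw) = left , right
    where
    left : LeftSpecial w
    left a = Sub⇒ζ>0 aw
    left b = Sub⇒ζ>0 bw
    right : RightSpecial w
    right a = Sub⇒ζ>0 wa
    right b = Sub⇒ζ>0 wb

  finite : ∀ {i} → 0 < i → i ≤ n → ∃ λ w → forks i ≡ fin w
  finite {i} 0<i i≤n = cases (forks i) refl
    where
    cases : ∀ f → forks i ≡ f → ∃ λ w → forks i ≡ fin w
    cases (fin w) eq = w , eq
    cases W       eq = contradiction (inj i 0 i≤n z≤n (trans eq (sym forks-0))) (m<n⇒n≢0 0<i)

  zs-fin : ∀ {i w} → forks i ≡ fin w → zs i ≡ ζ w
  zs-fin eq = trans (cong (zF u) eq) (z≡ζ _)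

  open Enumerated (length u) ζ-long n forks zs
    (cong (zF u) forks-0)
    zs-fin
    (λ i≤j j≤n → zs-mono _ _ i≤j j≤n)
    finite
    (λ i≤n eq → fork⇒bispecial (subst (IsFork u) eq (fork _ i≤n)))
    (λ {w} bi → surj (fin w) (bispecial⇒fork bi))
    public

  psiOf⇒Psi : ∀ {p j} → 1 + p ≤ n → j ≤ n → PsiOf u (forks (1 + p)) (forks j) → Psi p j
  psiOf⇒Psi {p} {j} p<n j≤n = cases (forks (1 + p)) (forks j) refl refl
    where
    cases : ∀ f g → forks (1 + p) ≡ f → forks j ≡ g → PsiOf u f g → Psi p j
    cases (fin F) (fin G) vF vG ((x ∷ S , _ , eq) , _ , longest) = record
      { j≤n   = j≤n
      ; vF    = vF
      ; vG    = vG
      ; F≡GxS = eq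
      ; ζGx   = trans
          (longest-prefix-ζ (fork⇒bispecial (subst (IsFork u) vF (fork _ p<n))) G x S eq
            λ H H⊏F bi → longest H H⊏F (bispecial⇒fork bi))
          (sym (zs-fin vF))
      }
    cases (fin F) (fin G) vF vG (([] , []≢[] , _) , _) = contradiction refl []≢[]

open ForkEnumeration

theorem3p16 : (u : Word) → u ≢ [] → ¬ Periodic u →
    (n : ℕ) (E : ForkEnumeration u n) →
    (j : (i : ℕ) → Exceptional E i → ℕ) →
    (∀ i (e : Exceptional E i) → j i e ≤ n × PsiOf u (v E (i ∸ 1)) (v E (j i e))) →
    Σ ((i : ℕ) → Exceptional E i → ℕ) λ k →
    (∀ i (e : Exceptional E i) →
    (i < k i e × k i e < j i e)
    × zs E (j i e) ≤ zs E (j i e ∸ 1) + zs E (i ∸ 1)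
    × zs E (k i e) ≤ zs E (k i e ∸ 1) + zs E (i ∸ 2))
    × (∀ i i' (e : Exceptional E i) (e' : Exceptional E i') → i ≢ i' → j i e ≢ j i' e')
    × (∀ i i' (e : Exceptional E i) (e' : Exceptional E i') → k i e ≢ j i' e')
    × (∀ i (e : Exceptional E i) → Regular E (j i e) × Regular E (k i e))
theorem3p16 u u≢[] ¬per n E j jΨ = k , k-bounds , j-distinct , k≢j , regular
  where
  open ForkSequence u u≢[] ¬per n E

  ψ : ∀ p (e : Exceptional E (2 + p)) → Psi p (j (2 + p) e)
  ψ p e = psiOf⇒Psi (<⇒≤ (proj₁ (proj₂ e))) (proj₁ (jΨ (2 + p) e)) (proj₂ (jΨ (2 + p) e))

  open Indices j ψ

  k : ∀ i → Exceptional E i → ℕ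
  k 0             (() , _)
  k 1             (s≤s () , _)
  k (suc (suc p)) e = proj₁ (select e)

  k-bounds : ∀ i (e : Exceptional E i) →
             (i < k i e × k i e < j i e)
             × zs E (j i e) ≤ zs E (j i e ∸ 1) + zs E (i ∸ 1)
             × zs E (k i e) ≤ zs E (k i e ∸ 1) + zs E (i ∸ 2)
  k-bounds 0             (() , _)
  k-bounds 1             (s≤s () , _)
  k-bounds (suc (suc p)) e with select e
  ... | k , k<j , isK = (IsK.i<k isK , k<j) , j-bound e , IsK.bound isK

  j-distinct : ∀ i i′ (e : Exceptional E i) (e′ : Exceptional E i′) → i ≢ i′ → j i e ≢ j i′ e′
  j-distinct 0             _              (() , _)
  j-distinct 1             _              (s≤s () , _)
  j-distinct (suc (suc _)) 0              _ (() , _)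
  j-distinct (suc (suc _)) 1              _ (s≤s () , _)
  j-distinct (suc (suc _)) (suc (suc _)) e e′ i≢i′ = j-injective e e′ λ p≡p′ → i≢i′ (cong (2 +_) p≡p′)

  k≢j : ∀ i i′ (e : Exceptional E i) (e′ : Exceptional E i′) → k i e ≢ j i′ e′
  k≢j 0             _  (() , _)
  k≢j 1             _  (s≤s () , _)
  k≢j (suc (suc p)) i′ e e′ = IsK.notJ (proj₂ (proj₂ (select e))) i′ e′

  regular : ∀ i (e : Exceptional E i) → Regular E (j i e) × Regular E (k i e)
  regular 0             (() , _)
  regular 1             (s≤s () , _)
  regular (suc (suc p)) e = j-regular e , IsK.regular (proj₂ (proj₂ (select e)))
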